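{- Let $x_0=1$ and let $w$ be the associated word. For every integer $m\ge1$, $$P(w,m)\ \ge\ \Bigl\lfloor\tfrac{41(m-1)}{24}\Bigr\rfloor+1.$$
   Context: With $x_0=1$, the orbit is defined by $x_{n+1}=\lceil 3x_n/2\rceil$ for $n\ge0$, and the word $w=(w_n)_{n\ge0}$ by $w_n=x_n\bmod 2\in\{0,1\}$; equivalently $w_n=2x_{n+1}-3x_n$. The complexity $P(w,m)$ is the number of distinct vectors $(w_j,w_{j+1},\dots,w_{j+m-1})$ as $j$ ranges over all non-negative integers. -}

module Defs where

open import Data.Fin using (Fin; toℕ)
open import Data.List using (List; length)
open import Data.List.Membership.Propositional using (_∈_)
open import Data.List.Relation.Unary.All using (All)
open import Data.List.Relation.Unary.Unique.Propositional using (Unique)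
open import Data.Nat using (ℕ; zero; suc; _+_; _*_; ⌈_/2⌉)
open import Data.Nat.DivMod using (_mod_)
open import Data.Product using (_×_; ∃-syntax)
open import Data.Vec using (Vec; tabulate)
open import Function.Bundles using (_⇔_)
open import Relation.Binary.PropositionalEquality using (_≡_)

x : ℕ → ℕ
x zero    = 1
x (suc n) = ⌈ 3 * x n /2⌉

w : ℕ → Fin 2
w n = x n mod 2

module _ {A : Set} where

  factor : (ℕ → A) → (m : ℕ) → ℕ → Vec A m
  factor u m j = tabulate (λ i → u (j + toℕ i))

  IsFactor : (ℕ → A) → (m : ℕ) → Vec A m → Set
  IsFactor u m v = ∃[ j ] v ≡ factor u m j

  -- P(u,m) = c.  This is a relation rather than a function because being a
  -- factor of an infinite word is not decidable in general, so the set of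
  -- factors cannot be counted by a total Agda function.
  IsComplexity : (ℕ → A) → ℕ → ℕ → Set
  IsComplexity u m c =
    ∃[ vs ] Unique vs × (∀ (v : Vec A m) → v ∈ vs ⇔ IsFactor u m v) × length vs ≡ c

  -- P(u,m) ≥ k, with explicit witnesses.  Unlike a bound on every c with
  -- IsComplexity u m c, this does not presuppose that the complete list of
  -- factors can be exhibited.
  ComplexityAtLeast : (ℕ → A) → ℕ → ℕ → Set
  ComplexityAtLeast u m k =
    ∃[ vs ] Unique vs × All (IsFactor u m) vs × length vs ≡ k

{-# OPTIONS --safe #-}

-- A factor of length m read at position j determines x j modulo 2 ^ m,
-- because 2 x (j + 1) = 3 x j + w j and 3 is invertible modulo powers of 2.
-- So P(w, m) is at least the number of j with x j < 2 ^ m, the orbit being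
-- strictly increasing.  Since x j + 1 grows at most by a factor 3/2 per step,
-- x j < 2 (3/2) ^ j, and this is at most 2 ^ m as soon as 24 j ≤ 41 (m - 1),
-- thanks to 3 ^ 41 ≤ 2 ^ 65.

module Submission where

open import Data.Fin using (Fin; toℕ)
open import Data.Fin.Properties using (injective⇒≤; toℕ-fromℕ<; toℕ-injective; toℕ<n; toℕ≤pred[n])
open import Data.List using (tabulate)
open import Data.List.Membership.Propositional using (_∈_)
open import Data.List.Membership.Setoid.Properties using (index-injective)
open import Data.List.Properties using (length-tabulate)
open import Data.List.Relation.Unary.Any using (index)
import Data.List.Relation.Unary.All.Properties as All
import Data.List.Relation.Unary.Unique.Propositional.Properties as Unique
open import Data.Nat using (ℕ; zero; suc; _+_; _*_; _∸_; _^_; _⊔_; _≤_; _<_; _≥_; ∣_-_∣; ⌈_/2⌉; NonZero; s≤s; z<s)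
open import Data.Nat.Coprimality using (Coprime; coprime?; coprime-divisor; 1-coprimeTo)
open import Data.Nat.DivMod using (_/_; _%_; m%n<n; m/n*n≤m; [m+kn]%n≡m%n)
open import Data.Nat.Divisibility using (_∣_; 1∣_; >⇒∤; ∣-trans; *-monoʳ-∣)
open import Data.Nat.Properties
open import Data.Nat.Tactic.RingSolver using (solve-∀)
open import Data.Product using (_×_; _,_)
open import Data.Sum using (inj₁; inj₂)
open import Data.Vec using (Vec)
import Data.Vec as Vec
open import Data.Vec.Properties using (∷-injective; tabulate-cong)
open import Function using (_∘_)
open import Function.Bundles using (module Equivalence)
open import Relation.Binary.Definitions using (tri<; tri≈; tri>)
open import Relation.Binary.PropositionalEquality using (_≡_; refl; sym; trans; cong; cong₂; subst; setoid; module ≡-Reasoning)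
open import Relation.Nullary using (contradiction)
open import Relation.Nullary.Decidable using (toWitness)
open import Defs

increasing-steps⇒< : (f : ℕ → ℕ) → (∀ n → f n < f (suc n)) → ∀ {i j} → i < j → f i < f j
increasing-steps⇒< f step {i} {suc j} (s≤s i≤j) with m≤n⇒m<n∨m≡n i≤j
... | inj₁ i<j  = <-trans (increasing-steps⇒< f step i<j) (step j)
... | inj₂ refl = step i

increasing-steps⇒injective : (f : ℕ → ℕ) → (∀ n → f n < f (suc n)) → ∀ {i j} → f i ≡ f j → i ≡ j
increasing-steps⇒injective f step {i} {j} eq with <-cmp i j
... | tri< i<j _ _ = contradiction eq (<⇒≢ (increasing-steps⇒< f step i<j))
... | tri≈ _ i≡j _ = i≡j
... | tri> _ _ j<i = contradiction (sym eq) (<⇒≢ (increasing-steps⇒< f step j<i))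

^-cancelʳ-≤ : ∀ o .{{_ : NonZero o}} {m n} → m ^ o ≤ n ^ o → m ≤ n
^-cancelʳ-≤ o m^o≤n^o = ≮⇒≥ (λ n<m → <⇒≱ (^-monoˡ-< o n<m) m^o≤n^o)

-- A nonzero multiple of `d` is at least `d`, but the distance is at most the larger of the two
-- numbers, hence smaller than `d`.
∣∣m-n∣∧<⇒≡ : ∀ {d m n} → d ∣ ∣ m - n ∣ → m < d → n < d → m ≡ n
∣∣m-n∣∧<⇒≡ {d} {m} {n} d∣ m<d n<d with ∣ m - n ∣ in eq
... | zero  = ∣m-n∣≡0⇒m≡n eq
... | suc k = contradiction d∣ (>⇒∤ (begin-strict
  suc k      ≡⟨ eq ⟨
  ∣ m - n ∣  ≤⟨ ∣m-n∣≤m⊔n m n ⟩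
  m ⊔ n      <⟨ ⊔-lub m<d n<d ⟩
  d          ∎))
  where open ≤-Reasoning

-- Let `d` divide both `m * n` and `o`. Anything dividing `d` and `m` also divides `o`, so `d` is
-- coprime to `m` and therefore divides `n`.
coprime-*ˡ : ∀ {m n o} → Coprime m o → Coprime n o → Coprime (m * n) o
coprime-*ˡ m⊥o n⊥o (d∣mn , d∣o) =
  n⊥o (coprime-divisor (λ (e∣d , e∣m) → m⊥o (e∣m , ∣-trans e∣d d∣o)) d∣mn , d∣o)

coprime-^ˡ : ∀ {m n} → Coprime m n → ∀ k → Coprime (m ^ k) n
coprime-^ˡ {n = n} m⊥n zero    = 1-coprimeTo n
coprime-^ˡ         m⊥n (suc k) = coprime-*ˡ m⊥n (coprime-^ˡ m⊥n k)

2*⌈n/2⌉≡n%2+n : ∀ n → 2 * ⌈ n /2⌉ ≡ n % 2 + n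
2*⌈n/2⌉≡n%2+n zero          = refl
2*⌈n/2⌉≡n%2+n (suc zero)    = refl
2*⌈n/2⌉≡n%2+n (suc (suc n)) = begin
  2 * suc ⌈ n /2⌉                ≡⟨ *-suc 2 ⌈ n /2⌉ ⟩
  2 + 2 * ⌈ n /2⌉                ≡⟨ cong (2 +_) (2*⌈n/2⌉≡n%2+n n) ⟩
  -- `suc (suc n) % 2` computes to `n % 2`, so only the 2 has to move.
  2 + (n % 2 + n)                ≡⟨ move (n % 2) n ⟩
  suc (suc n) % 2 + suc (suc n)  ∎
  where
  open ≡-Reasoning
  move : ∀ a b → 2 + (a + b) ≡ a + (2 + b)
  move = solve-∀

-- Rounding `3 * x n` up to an even number adds its parity, which is that of `x n`, since they
-- differ by `x n * 2`.
2*x[1+n] : ∀ n → 2 * x (suc n) ≡ toℕ (w n) + 3 * x n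
2*x[1+n] n = begin
  2 * x (suc n)                  ≡⟨ 2*⌈n/2⌉≡n%2+n (3 * x n) ⟩
  (3 * x n) % 2 + 3 * x n        ≡⟨ cong (λ t → t % 2 + 3 * x n) (3*a≡a+a*2 (x n)) ⟩
  (x n + x n * 2) % 2 + 3 * x n  ≡⟨ cong (_+ 3 * x n) ([m+kn]%n≡m%n (x n) (x n) 2) ⟩
  x n % 2 + 3 * x n              ≡⟨ cong (_+ 3 * x n) (toℕ-fromℕ< (m%n<n (x n) 2)) ⟨
  toℕ (w n) + 3 * x n            ∎
  where
  open ≡-Reasoning
  3*a≡a+a*2 : ∀ a → 3 * a ≡ a + a * 2
  3*a≡a+a*2 = solve-∀

factor-injectiveˡ : ∀ {A : Set} (u : ℕ → A) m i j →
  factor u (suc m) i ≡ factor u (suc m) j → u i ≡ u j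
factor-injectiveˡ u m i j eq with u[i+0]≡u[j+0] , _ ← ∷-injective eq = begin
  u i        ≡⟨ cong u (+-identityʳ i) ⟨
  u (i + 0)  ≡⟨ u[i+0]≡u[j+0] ⟩
  u (j + 0)  ≡⟨ cong u (+-identityʳ j) ⟩
  u j        ∎
  where open ≡-Reasoning

factor-injectiveʳ : ∀ {A : Set} (u : ℕ → A) m i j →
  factor u (suc m) i ≡ factor u (suc m) j → factor u m (suc i) ≡ factor u m (suc j)
factor-injectiveʳ u m i j eq with _ , tails ← ∷-injective eq =
  trans (shift i) (trans tails (sym (shift j)))
  where
  shift : ∀ k → factor u m (suc k) ≡ Vec.tabulate (λ l → u (k + suc (toℕ l)))
  shift k = tabulate-cong (λ l → cong u (sym (+-suc k (toℕ l))))

-- Induction on `m`, moving both positions forward. The tails control the difference of the next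
-- terms; the equal first letters cancel in the recurrence, so twice that difference is 3 times the
-- current one. This gains one factor 2, and the 3 is removed by coprimality.
factor-w≡⇒2^m∣∣x-x∣ : ∀ m i j → factor w m i ≡ factor w m j → 2 ^ m ∣ ∣ x i - x j ∣
factor-w≡⇒2^m∣∣x-x∣ zero    _ _ _  = 1∣ _
factor-w≡⇒2^m∣∣x-x∣ (suc m) i j eq =
  coprime-divisor (coprime-^ˡ 2⊥3 (suc m)) (subst (2 ^ suc m ∣_) 2∣x′-x′∣≡3∣x-x∣
    (*-monoʳ-∣ 2 (factor-w≡⇒2^m∣∣x-x∣ m (suc i) (suc j) (factor-injectiveʳ w m i j eq))))
  where
  open ≡-Reasoning

  2⊥3 : Coprime 2 3
  2⊥3 = toWitness {a? = coprime? 2 3} _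

  2∣x′-x′∣≡3∣x-x∣ : 2 * ∣ x (suc i) - x (suc j) ∣ ≡ 3 * ∣ x i - x j ∣
  2∣x′-x′∣≡3∣x-x∣ = begin
    2 * ∣ x (suc i) - x (suc j) ∣
      ≡⟨ *-distribˡ-∣-∣ 2 (x (suc i)) (x (suc j)) ⟩
    ∣ 2 * x (suc i) - 2 * x (suc j) ∣
      ≡⟨ cong₂ ∣_-_∣ (2*x[1+n] i) (2*x[1+n] j) ⟩
    ∣ toℕ (w i) + 3 * x i - toℕ (w j) + 3 * x j ∣
      ≡⟨ cong (λ a → ∣ toℕ (w i) + 3 * x i - toℕ a + 3 * x j ∣) (factor-injectiveˡ w m i j eq) ⟨
    ∣ toℕ (w i) + 3 * x i - toℕ (w i) + 3 * x j ∣
      ≡⟨ ∣m+n-m+o∣≡∣n-o∣ (toℕ (w i)) (3 * x i) (3 * x j) ⟩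
    ∣ 3 * x i - 3 * x j ∣
      ≡⟨ *-distribˡ-∣-∣ 3 (x i) (x j) ⟨
    3 * ∣ x i - x j ∣
      ∎

-- Positivity is a hypothesis because `0<x` relies on this growth in its own induction.
0<x⇒x<x[1+n] : ∀ n → 0 < x n → x n < x (suc n)
0<x⇒x<x[1+n] n 0<x = *-cancelˡ-< 2 (x n) (x (suc n)) (begin-strict
  2 * x n                ≡⟨ +-identityʳ (2 * x n) ⟨
  2 * x n + 0            <⟨ +-monoʳ-< (2 * x n) 0<x ⟩
  2 * x n + x n          ≡⟨ +-comm (2 * x n) (x n) ⟩
  3 * x n                ≤⟨ m≤n+m (3 * x n) (toℕ (w n)) ⟩
  toℕ (w n) + 3 * x n    ≡⟨ 2*x[1+n] n ⟨
  2 * x (suc n)          ∎)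
  where open ≤-Reasoning

0<x : ∀ n → 0 < x n
0<x zero    = z<s
0<x (suc n) = <-trans (0<x n) (0<x⇒x<x[1+n] n (0<x n))

x-injective : ∀ {i j} → x i ≡ x j → i ≡ j
x-injective = increasing-steps⇒injective x (λ n → 0<x⇒x<x[1+n] n (0<x n))

-- The shift by 1 absorbs the rounding: a letter is at most 1, and 2 + 1 = 3.
2*[1+x[1+n]]≤3*[1+x[n]] : ∀ n → 2 * suc (x (suc n)) ≤ 3 * suc (x n)
2*[1+x[1+n]]≤3*[1+x[n]] n = begin
  2 * suc (x (suc n))        ≡⟨ *-suc 2 (x (suc n)) ⟩
  2 + 2 * x (suc n)          ≡⟨ cong (2 +_) (2*x[1+n] n) ⟩
  2 + (toℕ (w n) + 3 * x n)  ≤⟨ +-monoʳ-≤ 2 (+-monoˡ-≤ (3 * x n) (toℕ≤pred[n] (w n))) ⟩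
  3 + 3 * x n                ≡⟨ *-suc 3 (x n) ⟨
  3 * suc (x n)              ∎
  where open ≤-Reasoning

2^n*[1+x[n]]≤3^n*2 : ∀ n → 2 ^ n * suc (x n) ≤ 3 ^ n * 2
2^n*[1+x[n]]≤3^n*2 zero    = ≤-refl
2^n*[1+x[n]]≤3^n*2 (suc n) = begin
  2 * 2 ^ n * suc (x (suc n))    ≡⟨ swap 2 (2 ^ n) (suc (x (suc n))) ⟩
  2 ^ n * (2 * suc (x (suc n)))  ≤⟨ *-monoʳ-≤ (2 ^ n) (2*[1+x[1+n]]≤3*[1+x[n]] n) ⟩
  2 ^ n * (3 * suc (x n))        ≡⟨ swap 3 (2 ^ n) (suc (x n)) ⟨
  3 * 2 ^ n * suc (x n)          ≡⟨ *-assoc 3 (2 ^ n) (suc (x n)) ⟩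
  3 * (2 ^ n * suc (x n))        ≤⟨ *-monoʳ-≤ 3 (2^n*[1+x[n]]≤3^n*2 n) ⟩
  3 * (3 ^ n * 2)                ≡⟨ *-assoc 3 (3 ^ n) 2 ⟨
  3 * 3 ^ n * 2                  ∎
  where
  open ≤-Reasoning
  swap : ∀ a b c → a * b * c ≡ b * (a * c)
  swap = solve-∀

-- Comparing 41st powers turns the bound 65/41 for the binary logarithm of 3 into integer
-- arithmetic. As 65 = 41 + 24, the exponent exceeds `41 * n` by `24 * n`, which `41 * k` covers.
24*n≤41*k⇒3^n≤2^[n+k] : ∀ n k → 24 * n ≤ 41 * k → 3 ^ n ≤ 2 ^ (n + k)
24*n≤41*k⇒3^n≤2^[n+k] n k 24n≤41k = ^-cancelʳ-≤ 41 (begin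
  (3 ^ n) ^ 41        ≡⟨ ^-*-assoc 3 n 41 ⟩
  3 ^ (n * 41)        ≡⟨ cong (3 ^_) (*-comm n 41) ⟩
  3 ^ (41 * n)        ≡⟨ ^-*-assoc 3 41 n ⟨
  (3 ^ 41) ^ n        ≤⟨ ^-monoˡ-≤ n (≤ᵇ⇒≤ (3 ^ 41) (2 ^ 65) _) ⟩
  (2 ^ 65) ^ n        ≡⟨ ^-*-assoc 2 65 n ⟩
  2 ^ (65 * n)        ≤⟨ ^-monoʳ-≤ 2 65n≤[n+k]41 ⟩
  2 ^ ((n + k) * 41)  ≡⟨ ^-*-assoc 2 (n + k) 41 ⟨
  (2 ^ (n + k)) ^ 41  ∎)
  where
  open ≤-Reasoning
  65n≤[n+k]41 : 65 * n ≤ (n + k) * 41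
  65n≤[n+k]41 = begin
    65 * n           ≡⟨ *-distribʳ-+ n 41 24 ⟩
    41 * n + 24 * n  ≤⟨ +-monoʳ-≤ (41 * n) 24n≤41k ⟩
    41 * n + 41 * k  ≡⟨ *-distribˡ-+ 41 n k ⟨
    41 * (n + k)     ≡⟨ *-comm 41 (n + k) ⟩
    (n + k) * 41     ∎

24*n≤41*k⇒x[n]<2^[1+k] : ∀ n k → 24 * n ≤ 41 * k → x n < 2 ^ suc k
-- The strict bound on `x n` unfolds to a weak one on `suc (x n)`, the quantity whose growth is
-- controlled.
24*n≤41*k⇒x[n]<2^[1+k] n k 24n≤41k = *-cancelˡ-≤ (2 ^ n) {{m^n≢0 2 n}} (begin
  2 ^ n * suc (x n)    ≤⟨ 2^n*[1+x[n]]≤3^n*2 n ⟩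
  3 ^ n * 2            ≤⟨ *-monoˡ-≤ 2 (24*n≤41*k⇒3^n≤2^[n+k] n k 24n≤41k) ⟩
  2 ^ (n + k) * 2      ≡⟨ cong (_* 2) (^-distribˡ-+-* 2 n k) ⟩
  2 ^ n * 2 ^ k * 2    ≡⟨ *-assoc (2 ^ n) (2 ^ k) 2 ⟩
  2 ^ n * (2 ^ k * 2)  ≡⟨ cong (2 ^ n *_) (*-comm (2 ^ k) 2) ⟩
  2 ^ n * 2 ^ suc k    ∎)
  where open ≤-Reasoning

InjectiveBelow : ∀ {A : Set} → ℕ → (ℕ → A) → Set
InjectiveBelow k f = ∀ {i j} → i < k → j < k → f i ≡ f j → i ≡ j

module _ {A : Set} (u : ℕ → A) (m : ℕ) {k : ℕ} (inj : InjectiveBelow k (factor u m)) where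

  private
    f : Fin k → Vec A m
    f i = factor u m (toℕ i)

    f-injective : ∀ {i j} → f i ≡ f j → i ≡ j
    f-injective {i} {j} = toℕ-injective ∘ inj (toℕ<n i) (toℕ<n j)

  factors-injective⇒ComplexityAtLeast : ComplexityAtLeast u m k
  factors-injective⇒ComplexityAtLeast =
    tabulate f , Unique.tabulate⁺ f-injective , All.tabulate⁺ (λ i → toℕ i , refl) , length-tabulate f

  -- Sending `i` to the place of the factor at position `i` in the complete list `vs` is an
  -- injection from `Fin k` into `Fin (length vs)`.
  factors-injective⇒IsComplexity≥ : ∀ {c} → IsComplexity u m c → c ≥ k
  factors-injective⇒IsComplexity≥ (vs , _ , vs-factors , refl) = injective⇒≤ {f = index ∘ f∈vs}
    (λ {i} {j} eq → f-injective (index-injective (setoid _) (f∈vs i) (f∈vs j) eq))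
    where
    f∈vs : ∀ i → f i ∈ vs
    f∈vs i = Equivalence.from (vs-factors (f i)) (toℕ i , refl)

-- Both terms lie below the modulus `2 ^ suc k`, so their congruence is an equality, and a strictly
-- increasing orbit has no repetition.
factor-w-injective : ∀ k → InjectiveBelow ((41 * k) / 24 + 1) (factor w (suc k))
factor-w-injective k {i} {j} i< j< eq =
  x-injective (∣∣m-n∣∧<⇒≡ (factor-w≡⇒2^m∣∣x-x∣ (suc k) i j eq) (x<2^ i<) (x<2^ j<))
  where
  open ≤-Reasoning
  x<2^ : ∀ {n} → n < (41 * k) / 24 + 1 → x n < 2 ^ suc k
  x<2^ {n} n< = 24*n≤41*k⇒x[n]<2^[1+k] n k (begin
    24 * n                ≡⟨ *-comm 24 n ⟩
    n * 24                ≤⟨ *-monoˡ-≤ 24 (m<1+n⇒m≤n (subst (n <_) (+-comm ((41 * k) / 24) 1) n<)) ⟩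
    (41 * k) / 24 * 24    ≤⟨ m/n*n≤m (41 * k) 24 ⟩
    41 * k                ∎)

corollary4p4 : ∀ (m : ℕ) → m ≥ 1 →
    (∀ (P : ℕ) → IsComplexity w m P → P ≥ (41 * (m ∸ 1)) / 24 + 1)
    × ComplexityAtLeast w m ((41 * (m ∸ 1)) / 24 + 1)
-- Writing the length as `suc k` makes `m ∸ 1` compute to `k`.
corollary4p4 (suc k) _ =
  (λ _ → factors-injective⇒IsComplexity≥ w (suc k) (factor-w-injective k)) ,
  factors-injective⇒ComplexityAtLeast w (suc k) (factor-w-injective k)
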